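{- Permutations whose $\Theta$-image is fixed under $\Theta$ are counted by the Catalan numbers: for every $n\ge 0$, $|S_{n,1}|=C_n=\frac{1}{n+1}\binom{2n}{n}$.
   Context: $S_n$ is the set of permutations of $\{0,1,\ldots,n-1\}$, written as sequences of length $n$. $I_n$ is the set of inversion sequences of length $n$, i.e. integer sequences $\sigma=(\sigma_1,\ldots,\sigma_n)$ with $0\le\sigma_i<i$ for every $1\le i\le n$ (the empty sequence is allowed, with $n=0$). For a finite integer sequence $\sigma$ of length $n$, $\Theta(\sigma)$ is the sequence of length $n$ defined by $\Theta(\sigma)_i=\#\{j<i:\sigma_j<\sigma_i\}$. $FP_n=\{\sigma\in I_n:\Theta(\sigma)=\sigma\}$ and $S_{n,1}=\{\sigma\in S_n:\Theta(\sigma)\in FP_n\}$. -}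

module Defs where

open import Level using (Level; 0ℓ; _⊔_)
open import Data.Nat.Base as ℕ using (ℕ; zero; suc; _*_)
import Data.Nat.Properties as ℕ
open import Data.Nat.Combinatorics using (_C_; nCk+nC[k+1]≡[n+1]C[k+1]; nC1≡n)
open import Data.Nat.Divisibility using (_∣_; divides; ∣m+n∣m⇒∣n; m∣m*n)
open import Data.Nat.DivMod using (_/_; m*[n/m]≡n)
open import Data.Nat.Tactic.RingSolver using (solve-∀)
open import Data.Integer.Base as ℤ using (ℤ; +_)
import Data.Integer.Properties as ℤ
open import Data.Fin.Base as Fin using (Fin; toℕ)
import Data.Fin.Properties as Fin
open import Data.Fin.Permutation using (Permutation′; _⟨$⟩ʳ_)
open import Data.Vec.Base using (Vec; lookup; tabulate; count; allFin)
open import Data.List.Base using (List; length)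
open import Data.List.Membership.Propositional using (_∈_)
open import Data.List.Relation.Unary.Unique.Propositional using (Unique)
open import Data.Product.Base using (Σ-syntax; _×_)
open import Function.Bundles using (_⇔_)
open import Relation.Nullary.Decidable using (_×-dec_)
open import Relation.Unary using (Pred)
open import Relation.Binary.PropositionalEquality

-- Positions are elements of Fin n, so the 1-based position of i is suc (toℕ i).

Θ : ∀ {n} → Vec ℤ n → Vec ℤ n
Θ {n} σ = tabulate λ i →
  + count (λ j → (j Fin.<? i) ×-dec (lookup σ j ℤ.<? lookup σ i)) (allFin n)

-- The sequences listing the values of a bijection of {0, …, n-1}.
S : ∀ n → Pred (Vec ℤ n) 0ℓ
S n σ = Σ[ π ∈ Permutation′ n ] (∀ i → lookup σ i ≡ + toℕ (π ⟨$⟩ʳ i))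

I : ∀ n → Pred (Vec ℤ n) 0ℓ
I n σ = ∀ i → (+ 0 ℤ.≤ lookup σ i) × (lookup σ i ℤ.< + suc (toℕ i))

FP : ∀ n → Pred (Vec ℤ n) 0ℓ
FP n σ = I n σ × Θ σ ≡ σ

S₁ : ∀ n → Pred (Vec ℤ n) 0ℓ
S₁ n σ = S n σ × FP n (Θ σ)

-- P holds of exactly k elements of A. Counting a duplicate-free list of the
-- elements, rather than the type Σ A P, avoids counting proofs of P: membership
-- in S n carries a bijection, which is not unique without function extensionality.
HasCardinality : ∀ {a p : Level} {A : Set a} → Pred A p → ℕ → Set (a ⊔ p)
HasCardinality {A = A} P k =
  Σ[ xs ∈ List A ] Unique xs × (∀ x → x ∈ xs ⇔ P x) × length xs ≡ k

-- The division is exact, see catalan-exact.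
catalan : ℕ → ℕ
catalan n = ((2 * n) C n) / suc n

[1+k]*[1+n]C[1+k]≡[1+n]*nCk : ∀ n k → suc k * (suc n C suc k) ≡ suc n * (n C k)
[1+k]*[1+n]C[1+k]≡[1+n]*nCk n zero = begin
  1 * (suc n C 1)  ≡⟨ ℕ.*-identityˡ _ ⟩
  suc n C 1        ≡⟨ nC1≡n (suc n) ⟩
  suc n            ≡⟨ ℕ.*-identityʳ _ ⟨
  suc n * (n C 0)  ∎
  where open ≡-Reasoning
[1+k]*[1+n]C[1+k]≡[1+n]*nCk zero (suc k) = ℕ.*-zeroʳ (suc (suc k))
[1+k]*[1+n]C[1+k]≡[1+n]*nCk (suc n) (suc k) = begin
  suc (suc k) * (suc (suc n) C suc (suc k))
    ≡⟨ cong (suc (suc k) *_) (nCk+nC[k+1]≡[n+1]C[k+1] (suc n) (suc k)) ⟨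
  suc (suc k) * (x ℕ.+ y)
    ≡⟨ split k x y ⟩
  x ℕ.+ (suc k * x ℕ.+ suc (suc k) * y)
    ≡⟨ cong (x ℕ.+_) (cong₂ ℕ._+_ ([1+k]*[1+n]C[1+k]≡[1+n]*nCk n k)
                                  ([1+k]*[1+n]C[1+k]≡[1+n]*nCk n (suc k))) ⟩
  x ℕ.+ (suc n * (n C k) ℕ.+ suc n * (n C suc k))
    ≡⟨ cong (x ℕ.+_) (ℕ.*-distribˡ-+ (suc n) (n C k) (n C suc k)) ⟨
  x ℕ.+ suc n * (n C k ℕ.+ n C suc k)
    ≡⟨ cong (λ z → x ℕ.+ suc n * z) (nCk+nC[k+1]≡[n+1]C[k+1] n k) ⟩
  suc (suc n) * x ∎
  where
  open ≡-Reasoning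
  x = suc n C suc k
  y = suc n C suc (suc k)
  split : ∀ k x y → suc (suc k) * (x ℕ.+ y) ≡ x ℕ.+ (suc k * x ℕ.+ suc (suc k) * y)
  split = solve-∀

[1+n]∣[2n]Cn : ∀ n → suc n ∣ (2 * n) C n
[1+n]∣[2n]Cn n = ∣m+n∣m⇒∣n
  (divides (2 * c) (sum n c))
  (subst (suc n ∣_) ([1+k]*[1+n]C[1+k]≡[1+n]*nCk (2 * n) n) (m∣m*n _))
  where
  c = (2 * n) C n
  sum : ∀ n c → suc (2 * n) * c ℕ.+ c ≡ 2 * c * suc n
  sum = solve-∀

catalan-exact : ∀ n → suc n * catalan n ≡ (2 * n) C n
catalan-exact n = m*[n/m]≡n ([1+n]∣[2n]Cn n)

{-# OPTIONS --safe #-}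
-- A permutation is determined by its Lehmer code Θ σ, and every inversion
-- sequence is the Lehmer code of a permutation, so the task is to count the
-- fixed points e of Θ.  Appending v to a fixed point e of length n gives a
-- fixed point exactly when v is a choice for e: v = #{j : e_j < v}.  Every
-- inversion sequence satisfies w ≤ #{j : e_j < w} for w ≤ n, so after appending
-- v no w with v < w ≤ n is a choice; hence the choices become the old choices
-- w ≤ v together with n + 1.  A node with k choices thus has children with
-- 2, …, k + 1 choices, which is the Catalan generating tree, and the sizes of
-- its levels are ballot numbers.
module Submission where

open import Defs
open import Data.Nat.Base using (ℕ)

import Algebra.Properties.CommutativeMonoid.Sum
open import Data.Bool.Base using (Bool; true; false; if_then_else_; _∧_)
open import Data.Fin.Base as Fin using (Fin; zero; suc; toℕ; fromℕ; inject₁; punchIn)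
open import Data.Fin.Permutation using (Permutation′; _⟨$⟩ʳ_; id; insert; remove;
  insert-punchIn; punchIn-permute)
open import Data.Fin.Properties using (fromℕ≢inject₁; toℕ-fromℕ;
  toℕ-inject₁; toℕ<n; toℕ≤n; toℕ≤pred[n];
  toℕ-injective; inject₁-injective; _≟_; _<?_; _≤?_)
open import Data.Fin.Relation.Unary.Top using (view; ‵fromℕ; ‵inject₁)
open import Data.Integer.Base as ℤ using (ℤ; +_)
import Data.Integer.Properties as ℤ
open import Data.List.Base as List using (List; []; _∷_; concatMap; filter; length)
open import Data.List.Membership.Propositional using (_∈_; find; lose)
open import Data.List.Membership.Propositional.Properties using (∈-map⁺; ∈-map⁻;
  ∈-filter⁺; ∈-filter⁻; ∈-concatMap⁺; ∈-concatMap⁻)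
import Data.List.Properties as List
open import Data.List.Relation.Binary.Disjoint.Propositional using (Disjoint)
open import Data.List.Relation.Unary.All as All using ([]; _∷_)
import Data.List.Relation.Unary.All.Properties as All
open import Data.List.Relation.Unary.AllPairs as AllPairs using (AllPairs; []; _∷_)
import Data.List.Relation.Unary.AllPairs.Properties as AllPairs
open import Data.List.Relation.Unary.Any using (here; there)
open import Data.List.Relation.Unary.Unique.Propositional using (Unique)
import Data.List.Relation.Unary.Unique.Propositional.Properties as Unique
open import Data.Nat.Base using (zero; suc; _+_; _*_; _≤_; _<_; _<ᵇ_; z≤n; s≤s)
open import Data.Nat.Combinatorics using (_C_; nCk≡nC[n∸k]; nCk+nC[k+1]≡[n+1]C[k+1])
open import Data.Nat.ListAction using (sum)
open import Data.Nat.ListAction.Properties using (sum-++)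
import Data.Nat.Properties as ℕ
open import Data.Nat.Tactic.RingSolver using (solve-∀)
open import Data.Product.Base using (∃-syntax; _×_; _,_)
open import Data.Sum.Base using (inj₁; inj₂)
open import Data.Unit.Base using (⊤; tt)
open import Data.Vec.Base as Vec using (Vec; lookup; tabulate; count)
import Data.Vec.Properties as Vec
open import Function.Base using (_∘_)
open import Function.Bundles using (_⇔_; mk⇔; Equivalence)
open import Relation.Binary.PropositionalEquality
open import Relation.Nullary.Decidable using (yes; no; does; dec-true; dec-false; _×-dec_)
open import Relation.Nullary.Negation using (contradiction)
open import Relation.Unary using (Pred; Decidable)

module ∑ = Algebra.Properties.CommutativeMonoid.Sum ℕ.+-0-commutativeMonoid
open ∑ using () renaming (sum to ∑)

open ≡-Reasoning

private
  variable
    n : ℕ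

-- Ballot numbers

-- Generation m below a node with k choices: its children have 2, …, k + 1 choices.
ballot : ℕ → ℕ → ℕ
ballot zero    k       = 1
ballot (suc m) zero    = 0
ballot (suc m) (suc k) = ballot m (suc (suc k)) + ballot (suc m) k

[i+j]Ci≡[i+j]Cj : ∀ i j → (i + j) C i ≡ (i + j) C j
[i+j]Ci≡[i+j]Cj i j =
  trans (nCk≡nC[n∸k] (ℕ.m≤m+n i j)) (cong ((i + j) C_) (ℕ.m+n∸m≡n i j))

-- The reflection principle: ballot (suc m) k = N C (m + 1) − N C m.
ballot-C : ∀ m k → let N = k + suc (2 * m) in
  ballot (suc m) k + N C m ≡ N C suc m
ballot-C m zero = begin
  suc (2 * m) C m      ≡⟨ cong (_C m) (split m) ⟩
  (m + suc m) C m      ≡⟨ [i+j]Ci≡[i+j]Cj m (suc m) ⟩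
  (m + suc m) C suc m  ≡⟨ cong (_C suc m) (split m) ⟨
  suc (2 * m) C suc m  ∎
  where
  split : ∀ m → suc (2 * m) ≡ m + suc m
  split = solve-∀
-- For `m = 0` the lower binomial is the constant 1, so a single Pascal step remains.
ballot-C zero (suc k) = begin
  suc (ballot 1 k) + 1         ≡⟨ cong suc (ballot-C zero k) ⟩
  1 + (k + 1) C 1              ≡⟨ nCk+nC[k+1]≡[n+1]C[k+1] (k + 1) 0 ⟩
  suc (k + 1) C 1              ∎
ballot-C (suc m) (suc k) = begin
  b + a + suc N C suc m                ≡⟨ cong (λ x → b + a + x) (nCk+nC[k+1]≡[n+1]C[k+1] N m) ⟨
  b + a + (N C m + N C suc m)          ≡⟨ regroup b a (N C m) (N C suc m) ⟩
  (b + N C m) + (a + N C suc m)        ≡⟨ cong₂ _+_ b-C (ballot-C (suc m) k) ⟩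
  N C suc m + N C suc (suc m)          ≡⟨ nCk+nC[k+1]≡[n+1]C[k+1] N (suc m) ⟩
  suc N C suc (suc m)                  ∎
  where
  N = k + suc (2 * suc m)
  a = ballot (suc (suc m)) k
  b = ballot (suc m) (suc (suc k))
  regroup : ∀ b a x y → b + a + (x + y) ≡ (b + x) + (a + y)
  regroup = solve-∀
  -- Both terms of the recursion refer to the same row `N`: two more choices make up for one
  -- generation less, so Pascal's rule applies to each column.
  shift : ∀ k m → suc (suc k) + suc (2 * m) ≡ k + suc (2 * suc m)
  shift = solve-∀
  b-C : b + N C m ≡ N C suc m
  b-C = subst (λ M → b + M C m ≡ M C suc m) (shift k m) (ballot-C m (suc (suc k)))

-- For `n = suc m`, reflection gives `b` as `M C suc m` minus `M C m` with `M = 2m + 2`. By `lower`,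
-- multiplying by `m + 2` turns the subtracted term into `suc m * (M C suc m)`, which leaves one
-- copy of the central binomial.
ballot≡catalan : ∀ n → ballot n 1 ≡ catalan n
ballot≡catalan zero    = refl
ballot≡catalan (suc m) = ℕ.*-cancelˡ-≡ b (catalan (suc m)) (2 + m) (begin
  (2 + m) * b          ≡⟨ ℕ.+-cancelʳ-≡ ((2 + m) * (M C m)) _ _ scaled ⟩
  M C suc m            ≡⟨ cong (_C suc m) (M≡ m) ⟨
  (2 * suc m) C suc m  ≡⟨ catalan-exact (suc m) ⟨
  (2 + m) * catalan (suc m) ∎)
  where
  b = ballot (suc m) 1
  N = suc (2 * m)
  M = suc N
  M≡ : ∀ m → 2 * suc m ≡ suc (suc (2 * m))
  M≡ = solve-∀
  N≡ : ∀ m → suc (2 * m) ≡ m + suc m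
  N≡ = solve-∀
  M≡′ : ∀ m → suc (suc (2 * m)) ≡ m + suc (suc m)
  M≡′ = solve-∀
  -- Symmetry moves column `m` to `m + 2`. Absorption then reduces both sides to row `N`, whose two
  -- middle entries agree.
  lower : (2 + m) * (M C m) ≡ suc m * (M C suc m)
  lower = begin
    (2 + m) * (M C m)              ≡⟨ cong (λ x → (2 + m) * (x C m)) (M≡′ m) ⟩
    (2 + m) * ((m + (2 + m)) C m)  ≡⟨ cong ((2 + m) *_) ([i+j]Ci≡[i+j]Cj m (2 + m)) ⟩
    (2 + m) * ((m + (2 + m)) C (2 + m))
                                 ≡⟨ cong (λ x → (2 + m) * (x C (2 + m))) (M≡′ m) ⟨
    (2 + m) * (M C (2 + m))        ≡⟨ [1+k]*[1+n]C[1+k]≡[1+n]*nCk N (suc m) ⟩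
    M * (N C suc m)                ≡⟨ cong (λ x → M * (x C suc m)) (N≡ m) ⟩
    M * ((m + suc m) C suc m)      ≡⟨ cong (M *_) ([i+j]Ci≡[i+j]Cj m (suc m)) ⟨
    M * ((m + suc m) C m)          ≡⟨ cong (λ x → M * (x C m)) (N≡ m) ⟨
    M * (N C m)                    ≡⟨ [1+k]*[1+n]C[1+k]≡[1+n]*nCk N m ⟨
    suc m * (M C suc m)            ∎
  scaled : (2 + m) * b + (2 + m) * (M C m) ≡ M C suc m + (2 + m) * (M C m)
  scaled = begin
    (2 + m) * b + (2 + m) * (M C m)   ≡⟨ ℕ.*-distribˡ-+ (2 + m) b (M C m) ⟨
    (2 + m) * (b + M C m)           ≡⟨ cong ((2 + m) *_) (ballot-C m 1) ⟩
    (2 + m) * (M C suc m)             ≡⟨ cong (_+_ (M C suc m)) lower ⟨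
    M C suc m + (2 + m) * (M C m)     ∎

-- Counting smaller entries

𝟙 : Bool → ℕ
𝟙 b = if b then 1 else 0

below : (Fin n → ℕ) → ℕ → ℕ
below f w = ∑ λ j → 𝟙 (f j <ᵇ w)

-- `Θ` on natural-valued functions, written as a sum of Boolean indicators so that the laws of
-- finite sums (splitting off the last term, reindexing) apply.
θ : (Fin n → ℕ) → Fin n → ℕ
θ f i = ∑ λ j → 𝟙 ((toℕ j <ᵇ toℕ i) ∧ (f j <ᵇ f i))

count-tabulate : ∀ {a p} {A : Set a} {P : Pred A p} (P? : Decidable P) (f : Fin n → A) →
  count P? (tabulate f) ≡ ∑ λ j → 𝟙 (does (P? (f j)))
count-tabulate {zero}  P? f = refl
count-tabulate {suc n} P? f with does (P? (f zero))
... | true  = cong suc (count-tabulate P? (f ∘ suc))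
... | false = count-tabulate P? (f ∘ suc)

Θ-tabulate : (f : Fin n → ℕ) → Θ (tabulate (+_ ∘ f)) ≡ tabulate (+_ ∘ θ f)
Θ-tabulate {n} f = Vec.tabulate-cong λ i → cong +_ (trans
  (count-tabulate (λ j → (j <? i) ×-dec (lookup σ j ℤ.<? lookup σ i)) (λ j → j))
  -- Between integers of the form `+ a` and `+ b` the decision computes to `a <ᵇ b`, so replacing
  -- the lookups already yields the summand of `θ`.
  (∑.sum-cong-≗ λ j → cong₂ (λ x y → 𝟙 ((toℕ j <ᵇ toℕ i) ∧ does (x ℤ.<? y)))
    (Vec.lookup∘tabulate (+_ ∘ f) j) (Vec.lookup∘tabulate (+_ ∘ f) i)))
  where σ = tabulate (+_ ∘ f)

θ-cong : {f g : Fin n → ℕ} → f ≗ g → θ f ≗ θ g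
θ-cong f≗g i = ∑.sum-cong-≗ λ j →
  cong₂ (λ x y → 𝟙 ((toℕ j <ᵇ toℕ i) ∧ (x <ᵇ y))) (f≗g j) (f≗g i)

below-cong : {f g : Fin n → ℕ} → f ≗ g → ∀ w → below f w ≡ below g w
below-cong f≗g w = ∑.sum-cong-≗ λ j → cong (λ x → 𝟙 (x <ᵇ w)) (f≗g j)

below-snoc : (f : Fin (suc n) → ℕ) → ∀ w →
  below f w ≡ below (f ∘ inject₁) w + 𝟙 (f (fromℕ n) <ᵇ w)
below-snoc f w = ∑.sum-init-last (λ j → 𝟙 (f j <ᵇ w))

<ᵇ-true : ∀ {m n} → m < n → (m <ᵇ n) ≡ true
<ᵇ-true {m} {n} = dec-true (m ℕ.<? n)

<ᵇ-false : ∀ {m n} → n ≤ m → (m <ᵇ n) ≡ false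
<ᵇ-false {m} {n} n≤m = dec-false (m ℕ.<? n) (ℕ.≤⇒≯ n≤m)

toℕ-inject₁≤ : (i : Fin n) → toℕ (inject₁ i) ≤ n
toℕ-inject₁≤ i = ℕ.≤-trans (ℕ.≤-reflexive (toℕ-inject₁ i)) (toℕ≤n i)

-- The last position never precedes `inject₁ i`, so its summand vanishes.
θ-inject₁ : (f : Fin (suc n) → ℕ) → ∀ i → θ f (inject₁ i) ≡ θ (f ∘ inject₁) i
θ-inject₁ {n} f i = begin
  θ f (inject₁ i)
    ≡⟨ ∑.sum-init-last (λ j → 𝟙 ((toℕ j <ᵇ toℕ (inject₁ i)) ∧ (f j <ᵇ f (inject₁ i)))) ⟩
  _ + 𝟙 ((toℕ (fromℕ n) <ᵇ toℕ (inject₁ i)) ∧ (f (fromℕ n) <ᵇ f (inject₁ i)))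
    ≡⟨ cong₂ _+_
         (∑.sum-cong-≗ λ j → cong₂ (λ x y → 𝟙 ((x <ᵇ y) ∧ (f (inject₁ j) <ᵇ f (inject₁ i))))
           (toℕ-inject₁ j) (toℕ-inject₁ i))
         (cong (λ b → 𝟙 (b ∧ (f (fromℕ n) <ᵇ f (inject₁ i)))) (<ᵇ-false
           (ℕ.≤-trans (toℕ-inject₁≤ i) (ℕ.≤-reflexive (sym (toℕ-fromℕ n)))))) ⟩
  θ (f ∘ inject₁) i + 0
    ≡⟨ ℕ.+-identityʳ _ ⟩
  θ (f ∘ inject₁) i ∎

θ-fromℕ : (f : Fin (suc n) → ℕ) → θ f (fromℕ n) ≡ below (f ∘ inject₁) (f (fromℕ n))
θ-fromℕ {n} f = begin
  θ f (fromℕ n)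
    ≡⟨ ∑.sum-init-last (λ j → 𝟙 ((toℕ j <ᵇ toℕ (fromℕ n)) ∧ (f j <ᵇ f (fromℕ n)))) ⟩
  _ + 𝟙 ((toℕ (fromℕ n) <ᵇ toℕ (fromℕ n)) ∧ (f (fromℕ n) <ᵇ f (fromℕ n)))
    ≡⟨ cong₂ _+_
         (∑.sum-cong-≗ λ j → cong (λ b → 𝟙 (b ∧ (f (inject₁ j) <ᵇ f (fromℕ n))))
           (<ᵇ-true (subst₂ _<_ (sym (toℕ-inject₁ j)) (sym (toℕ-fromℕ n)) (toℕ<n j))))
         (cong (λ b → 𝟙 (b ∧ (f (fromℕ n) <ᵇ f (fromℕ n)))) (<ᵇ-false (ℕ.≤-refl {toℕ (fromℕ n)}))) ⟩
  below (f ∘ inject₁) (f (fromℕ n)) + 0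
    ≡⟨ ℕ.+-identityʳ _ ⟩
  below (f ∘ inject₁) (f (fromℕ n)) ∎

below-full : (f : Fin n → ℕ) → ∀ w → (∀ i → f i < w) → below f w ≡ n
below-full {zero}  f w f< = refl
below-full {suc n} f w f< =
  cong₂ _+_ (cong 𝟙 (<ᵇ-true (f< zero))) (below-full (f ∘ suc) w (f< ∘ suc))

below-toℕ : ∀ n w → w ≤ n → below {n} toℕ w ≡ w
below-toℕ n       zero    _         = ∑.sum-replicate-zero n
below-toℕ (suc n) (suc w) (s≤s w≤n) = cong suc (below-toℕ n w w≤n)

-- Lehmer codes

infixl 5 _▸_

-- Inversion sequences grown on the right: the bound on each entry is built into its type.
data Code : ℕ → Set where
  []  : Code 0
  _▸_ : Code n → Fin (suc n) → Code (suc n)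

-- The appended entry becomes the last value of the permutation; earlier values at or above it are
-- raised by one, which keeps their relative order.
decode : Code n → Permutation′ n
decode []              = id
decode {suc n} (c ▸ v) = insert (fromℕ n) v (decode c)

word : Code n → Fin n → ℕ
word c i = toℕ (decode c ⟨$⟩ʳ i)

-- Defined through the decoded permutation; `val-inject₁` and `val-fromℕ` show that it lists the
-- entries of `c` itself.
val : Code n → Fin n → ℕ
val c = θ (word c)

snoc-elim : ∀ {p} (P : Fin (suc n) → Set p) →
  (∀ i → P (inject₁ i)) → P (fromℕ n) → ∀ i → P i
snoc-elim P init last i with view i
... | ‵fromℕ     = last
... | ‵inject₁ j = init j

punchIn-fromℕ : (i : Fin n) → punchIn (fromℕ n) i ≡ inject₁ i
punchIn-fromℕ zero    = refl
punchIn-fromℕ (suc i) = cong suc (punchIn-fromℕ i)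

punchIn-<ᵇ-pivot : (v : Fin (suc n)) (i : Fin n) → (toℕ (punchIn v i) <ᵇ toℕ v) ≡ (toℕ i <ᵇ toℕ v)
punchIn-<ᵇ-pivot zero    i       = refl
punchIn-<ᵇ-pivot (suc v) zero    = refl
punchIn-<ᵇ-pivot (suc v) (suc i) = punchIn-<ᵇ-pivot v i

punchIn-<ᵇ : (v : Fin (suc n)) (i j : Fin n) →
  (toℕ (punchIn v i) <ᵇ toℕ (punchIn v j)) ≡ (toℕ i <ᵇ toℕ j)
punchIn-<ᵇ zero    i       j       = refl
punchIn-<ᵇ (suc v) zero    zero    = refl
punchIn-<ᵇ (suc v) zero    (suc j) = refl
punchIn-<ᵇ (suc v) (suc i) zero    = refl
punchIn-<ᵇ (suc v) (suc i) (suc j) = punchIn-<ᵇ v i j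

insert-self : ∀ i (j : Fin (suc n)) (π : Permutation′ n) → insert i j π ⟨$⟩ʳ i ≡ j
insert-self i j π with i ≟ i
... | yes _  = refl
... | no i≢i = contradiction refl i≢i

decode-inject₁ : (c : Code n) (v : Fin (suc n)) → ∀ i →
  decode (c ▸ v) ⟨$⟩ʳ inject₁ i ≡ punchIn v (decode c ⟨$⟩ʳ i)
decode-inject₁ {n} c v i = trans
  (cong (decode (c ▸ v) ⟨$⟩ʳ_) (sym (punchIn-fromℕ i)))
  (insert-punchIn (fromℕ n) v (decode c) i)

decode-fromℕ : (c : Code n) (v : Fin (suc n)) → decode (c ▸ v) ⟨$⟩ʳ fromℕ n ≡ v
decode-fromℕ {n} c v = insert-self (fromℕ n) v (decode c)

-- The last value of `π` is the last code entry; deleting that position and value leaves a smaller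
-- permutation to encode. Agreement is pointwise, which is all that `word` sees.
decode-surjective : (π : Permutation′ n) → ∃[ c ] (∀ i → decode c ⟨$⟩ʳ i ≡ π ⟨$⟩ʳ i)
decode-surjective {zero}  π = [] , λ ()
decode-surjective {suc n} π with decode-surjective (remove (fromℕ n) π)
... | c , decode-c = c ▸ v , snoc-elim _
    (λ i → begin
      decode (c ▸ v) ⟨$⟩ʳ inject₁ i            ≡⟨ decode-inject₁ c v i ⟩
      punchIn v (decode c ⟨$⟩ʳ i)              ≡⟨ cong (punchIn v) (decode-c i) ⟩
      punchIn v (remove (fromℕ n) π ⟨$⟩ʳ i)    ≡⟨ punchIn-permute π (fromℕ n) i ⟨
      π ⟨$⟩ʳ punchIn (fromℕ n) i               ≡⟨ cong (π ⟨$⟩ʳ_) (punchIn-fromℕ i) ⟩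
      π ⟨$⟩ʳ inject₁ i                         ∎)
    (decode-fromℕ c v)
  where v = π ⟨$⟩ʳ fromℕ n

-- `punchIn v` is strictly monotone, so comparisons among the earlier values do not change.
val-inject₁ : (c : Code n) (v : Fin (suc n)) → ∀ i → val (c ▸ v) (inject₁ i) ≡ val c i
val-inject₁ c v i = begin
  θ (word (c ▸ v)) (inject₁ i)            ≡⟨ θ-inject₁ (word (c ▸ v)) i ⟩
  θ (word (c ▸ v) ∘ inject₁) i            ≡⟨ θ-cong (cong toℕ ∘ decode-inject₁ c v) i ⟩
  θ (λ j → toℕ (punchIn v (decode c ⟨$⟩ʳ j))) i
    ≡⟨ ∑.sum-cong-≗ (λ j → cong (λ b → 𝟙 ((toℕ j <ᵇ toℕ i) ∧ b))
         (punchIn-<ᵇ v (decode c ⟨$⟩ʳ j) (decode c ⟨$⟩ʳ i))) ⟩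
  θ (word c) i                            ∎

-- Raising the values at or above `v` does not affect which of them lie below `v`. Since `word c`
-- permutes 0, ..., n - 1, reindexing the sum reduces the count to the numbers below `v`.
val-fromℕ : (c : Code n) (v : Fin (suc n)) → val (c ▸ v) (fromℕ n) ≡ toℕ v
val-fromℕ {n} c v = begin
  θ (word (c ▸ v)) (fromℕ n)
    ≡⟨ θ-fromℕ (word (c ▸ v)) ⟩
  below (word (c ▸ v) ∘ inject₁) (word (c ▸ v) (fromℕ n))
    ≡⟨ below-cong (cong toℕ ∘ decode-inject₁ c v) (word (c ▸ v) (fromℕ n)) ⟩
  below (λ j → toℕ (punchIn v (decode c ⟨$⟩ʳ j))) (word (c ▸ v) (fromℕ n))
    ≡⟨ cong (below (λ j → toℕ (punchIn v (decode c ⟨$⟩ʳ j))) ∘ toℕ) (decode-fromℕ c v) ⟩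
  below (λ j → toℕ (punchIn v (decode c ⟨$⟩ʳ j))) (toℕ v)
    ≡⟨ ∑.sum-cong-≗ (λ j → cong 𝟙 (punchIn-<ᵇ-pivot v (decode c ⟨$⟩ʳ j))) ⟩
  below (word c) (toℕ v)
    ≡⟨ ∑.sum-permute (λ j → 𝟙 (toℕ j <ᵇ toℕ v)) (decode c) ⟨
  below {n} toℕ (toℕ v)
    ≡⟨ below-toℕ n (toℕ v) (toℕ≤pred[n] v) ⟩
  toℕ v ∎

θ-val-inject₁ : (c : Code n) (v : Fin (suc n)) → ∀ i →
  θ (val (c ▸ v)) (inject₁ i) ≡ θ (val c) i
θ-val-inject₁ c v i = trans (θ-inject₁ (val (c ▸ v)) i) (θ-cong (val-inject₁ c v) i)

θ-val-fromℕ : (c : Code n) (v : Fin (suc n)) →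
  θ (val (c ▸ v)) (fromℕ n) ≡ below (val c) (toℕ v)
θ-val-fromℕ c v = trans (θ-fromℕ (val (c ▸ v)))
  (trans (below-cong (val-inject₁ c v) (val (c ▸ v) (fromℕ _))) (cong (below (val c)) (val-fromℕ c v)))

val-injective : (c d : Code n) → val c ≗ val d → c ≡ d
val-injective []      []      _ = refl
val-injective (c ▸ v) (d ▸ w) c≗d = cong₂ _▸_
  (val-injective c d λ i →
    trans (sym (val-inject₁ c v i)) (trans (c≗d (inject₁ i)) (val-inject₁ d w i)))
  (toℕ-injective (trans (sym (val-fromℕ c v)) (trans (c≗d (fromℕ _)) (val-fromℕ d w))))

val≤ : (c : Code n) → ∀ i → val c i ≤ toℕ i
val≤ (c ▸ v) = snoc-elim _
  (λ i → subst₂ _≤_ (sym (val-inject₁ c v i)) (sym (toℕ-inject₁ i)) (val≤ c i))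
  (subst₂ _≤_ (sym (val-fromℕ c v)) (sym (toℕ-fromℕ _)) (toℕ≤pred[n] v))

below-val-▸ : (c : Code n) (v : Fin (suc n)) → ∀ w →
  below (val (c ▸ v)) w ≡ below (val c) w + 𝟙 (toℕ v <ᵇ w)
below-val-▸ c v w = trans (below-snoc (val (c ▸ v)) w)
  (cong₂ _+_ (below-cong (val-inject₁ c v) w) (cong (λ x → 𝟙 (x <ᵇ w)) (val-fromℕ c v)))

below-val-full : (c : Code n) → below (val c) n ≡ n
below-val-full {n} c = below-full (val c) n λ i → ℕ.≤-<-trans (val≤ c i) (toℕ<n i)

-- The first `w` entries of an inversion sequence are all below `w`. The induction drops last
-- entries, which can only lower the count, until the length is `w` and every entry counts.
w≤below-val : (c : Code n) → ∀ w → w ≤ n → w ≤ below (val c) w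
w≤below-val [] zero _ = z≤n
w≤below-val {suc n} (c ▸ v) w w≤1+n with ℕ.m≤n⇒m<n∨m≡n w≤1+n
... | inj₂ refl = ℕ.≤-reflexive (sym (below-val-full (c ▸ v)))
... | inj₁ (s≤s w≤n) = ℕ.≤-trans (w≤below-val c w w≤n)
  (ℕ.≤-trans (ℕ.m≤m+n _ _) (ℕ.≤-reflexive (sym (below-val-▸ c v w))))

-- The generating tree of fixed points

Valid : Code n → Set
Valid []      = ⊤
Valid (c ▸ v) = Valid c × below (val c) (toℕ v) ≡ toℕ v

-- The list runs from largest to smallest, which gives uniqueness and lets `sum-ballot-filter`
-- follow the ballot recursion.
choices : Code n → List (Fin (suc n))
choices []              = zero ∷ []
choices {suc n} (c ▸ v) = fromℕ (suc n) ∷ List.map inject₁ (filter (_≤? v) (choices c))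

Descending : List (Fin n) → Set
Descending = AllPairs (λ x y → y Fin.< x)

choices-descending : (c : Code n) → Descending (choices c)
choices-descending []      = [] ∷ []
choices-descending (c ▸ v) =
  All.map⁺ (All.universal (λ i → subst₂ _<_ (sym (toℕ-inject₁ i)) (sym (toℕ-fromℕ _)) (toℕ<n i)) _) ∷
  AllPairs.map⁺ (AllPairs.map (λ {x} {y} → subst₂ _<_ (sym (toℕ-inject₁ y)) (sym (toℕ-inject₁ x)))
    (AllPairs.filter⁺ (_≤? v) (choices-descending c)))

choices-unique : (c : Code n) → Unique (choices c)
choices-unique c = AllPairs.map (λ y<x x≡y → ℕ.<⇒≢ y<x (cong toℕ (sym x≡y))) (choices-descending c)

-- The top value exceeds every entry, so it is always a choice. For an older `u`, the entry `v`
-- changes the count only if `v < u`, and then the count overshoots `u`.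
∈-choices : (c : Code n) → Valid c → ∀ w → w ∈ choices c ⇔ below (val c) (toℕ w) ≡ toℕ w
∈-choices [] _ zero = mk⇔ (λ _ → refl) (λ _ → here refl)
∈-choices {suc n} (c ▸ v) (valid , _) = snoc-elim _ old
  (mk⇔ (λ _ → subst (λ w → below (val (c ▸ v)) w ≡ w) (sym (toℕ-fromℕ (suc n))) (below-val-full (c ▸ v)))
       (λ _ → here refl))
  where
  old : ∀ u → inject₁ u ∈ choices (c ▸ v) ⇔ below (val (c ▸ v)) (toℕ (inject₁ u)) ≡ toℕ (inject₁ u)
  old u rewrite toℕ-inject₁ u | below-val-▸ c v (toℕ u) = mk⇔ to from
    where
    to : inject₁ u ∈ choices (c ▸ v) → below (val c) (toℕ u) + 𝟙 (toℕ v <ᵇ toℕ u) ≡ toℕ u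
    to (here u≡n)  = contradiction (sym u≡n) fromℕ≢inject₁
    to (there u∈) with ∈-map⁻ inject₁ u∈
    ... | u′ , u′∈ , u≡u′ with inject₁-injective u≡u′
    ... | refl with ∈-filter⁻ (_≤? v) {xs = choices c} u′∈
    ... | u∈c , u≤v = begin
      below (val c) (toℕ u) + 𝟙 (toℕ v <ᵇ toℕ u)
        ≡⟨ cong₂ (λ x b → x + 𝟙 b) (Equivalence.to (∈-choices c valid u) u∈c) (<ᵇ-false u≤v) ⟩
      toℕ u + 0 ≡⟨ ℕ.+-identityʳ _ ⟩
      toℕ u     ∎
    from : below (val c) (toℕ u) + 𝟙 (toℕ v <ᵇ toℕ u) ≡ toℕ u → inject₁ u ∈ choices (c ▸ v)
    from eq with u ≤? v
    ... | yes u≤v = there (∈-map⁺ inject₁ (∈-filter⁺ (_≤? v)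
          (Equivalence.from (∈-choices c valid u) (begin
            below (val c) (toℕ u)      ≡⟨ ℕ.+-identityʳ _ ⟨
            below (val c) (toℕ u) + 0  ≡⟨ cong (λ b → below (val c) (toℕ u) + 𝟙 b) (<ᵇ-false u≤v) ⟨
            _                          ≡⟨ eq ⟩
            toℕ u                      ∎))
          u≤v))
    -- Here `v < u`: the count over `c` is at least `u` already, and `v` adds one more, so `eq`
    -- would force `1 + u ≤ u`.
    ... | no u≰v = contradiction
          (subst₂ _≤_ (ℕ.+-comm (toℕ u) 1) (begin
            below (val c) (toℕ u) + 1
              ≡⟨ cong (λ b → below (val c) (toℕ u) + 𝟙 b) (<ᵇ-true (ℕ.≰⇒> u≰v)) ⟨
            below (val c) (toℕ u) + 𝟙 (toℕ v <ᵇ toℕ u)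
              ≡⟨ eq ⟩
            toℕ u ∎)
            (ℕ.+-monoˡ-≤ 1 (w≤below-val c (toℕ u) (toℕ≤pred[n] u))))
          ℕ.1+n≰n

children : Code n → List (Code (suc n))
children c = List.map (c ▸_) (choices c)

level : ∀ n → List (Code n)
level zero    = [] ∷ []
level (suc n) = concatMap children (level n)

▸-injectiveˡ : {c d : Code n} {v w : Fin (suc n)} → c ▸ v ≡ d ▸ w → c ≡ d
▸-injectiveˡ refl = refl

▸-injectiveʳ : {c d : Code n} {v w : Fin (suc n)} → c ▸ v ≡ d ▸ w → v ≡ w
▸-injectiveʳ refl = refl

level-unique : ∀ n → Unique (level n)
level-unique zero    = [] ∷ []
level-unique (suc n) = Unique.concat⁺
  (All.map⁺ (All.universal (λ c → Unique.map⁺ ▸-injectiveʳ (choices-unique c)) (level n)))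
  (AllPairs.map⁺ (AllPairs.map disjoint (level-unique n)))
  where
  disjoint : {c d : Code n} → c ≢ d → Disjoint (children c) (children d)
  disjoint {c} {d} c≢d (x∈c , x∈d) with ∈-map⁻ (c ▸_) x∈c | ∈-map⁻ (d ▸_) x∈d
  ... | _ , _ , refl | _ , _ , c▸v≡d▸w = c≢d (▸-injectiveˡ c▸v≡d▸w)

∈-level⇒Valid : {c : Code n} → c ∈ level n → Valid c
∈-level⇒Valid {c = []} _ = tt
∈-level⇒Valid {suc n} {c ▸ v} c▸v∈ with find (∈-concatMap⁻ children {xs = level n} c▸v∈)
... | c′ , c∈ , c▸v∈′ with ∈-map⁻ (c′ ▸_) c▸v∈′
... | v′ , v∈ , refl = valid , Equivalence.to (∈-choices c valid v) v∈
  where valid = ∈-level⇒Valid c∈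

Valid⇒∈-level : (c : Code n) → Valid c → c ∈ level n
Valid⇒∈-level []      _             = here refl
Valid⇒∈-level (c ▸ v) (valid , v-ok) = ∈-concatMap⁺ children
  (lose (Valid⇒∈-level c valid) (∈-map⁺ (c ▸_) (Equivalence.from (∈-choices c valid v) v-ok)))

-- Sizes of the levels

-- In a descending list of length k, filtering at the successive entries keeps k, ..., 1 elements.
-- The sum is thus `ballot m (k + 1)` down to `ballot m 2`, the unfolded recursion. The head keeps
-- everything and is itself rejected by every later filter.
sum-ballot-filter : ∀ m {l : List (Fin n)} → Descending l →
  sum (List.map (λ v → ballot m (suc (length (filter (_≤? v) l)))) l) ≡ ballot (suc m) (length l)
sum-ballot-filter m []                      = refl
sum-ballot-filter m {x ∷ l} (l<x ∷ desc) = cong₂ _+_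
  (cong (ballot m ∘ suc ∘ length) (List.filter-all (_≤? x) (ℕ.≤-refl ∷ All.map ℕ.<⇒≤ l<x)))
  (trans
    (cong sum (List.map-cong-local (All.map
      (λ {v} v<x → cong (ballot m ∘ suc ∘ length) (List.filter-reject (_≤? v) {xs = l} (ℕ.<⇒≱ v<x)))
      l<x)))
    (sum-ballot-filter m desc))

sum-concatMap : ∀ {a b} {A : Set a} {B : Set b} (f : B → ℕ) (g : A → List B) → ∀ xs →
  sum (List.map f (concatMap g xs)) ≡ sum (List.map (sum ∘ List.map f ∘ g) xs)
sum-concatMap f g []       = refl
sum-concatMap f g (x ∷ xs) = begin
  sum (List.map f (g x List.++ concatMap g xs))
    ≡⟨ cong sum (List.map-++ f (g x) (concatMap g xs)) ⟩
  sum (List.map f (g x) List.++ List.map f (concatMap g xs))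
    ≡⟨ sum-++ (List.map f (g x)) _ ⟩
  sum (List.map f (g x)) + sum (List.map f (concatMap g xs))
    ≡⟨ cong (_+_ (sum (List.map f (g x)))) (sum-concatMap f g xs) ⟩
  sum (List.map (sum ∘ List.map f ∘ g) (x ∷ xs)) ∎

descendants : ℕ → Code n → ℕ
descendants m c = ballot m (length (choices c))

sum-descendants-children : ∀ m (c : Code n) →
  sum (List.map (descendants m) (children c)) ≡ descendants (suc m) c
sum-descendants-children m c = begin
  sum (List.map (descendants m) (List.map (c ▸_) (choices c)))
    ≡⟨ cong sum (List.map-∘ (choices c)) ⟨
  sum (List.map (λ v → descendants m (c ▸ v)) (choices c))
    -- The `suc` is the new top choice at the head of `choices (c ▸ v)`.
    ≡⟨ cong sum (List.map-cong (λ v → cong (ballot m ∘ suc)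
         (List.length-map inject₁ (filter (_≤? v) (choices c)))) (choices c)) ⟩
  sum (List.map (λ v → ballot m (suc (length (filter (_≤? v) (choices c))))) (choices c))
    ≡⟨ sum-ballot-filter m (choices-descending c) ⟩
  descendants (suc m) c ∎

-- The total depends only on the depth reached, so a generation can be traded between `m` and `n`
-- until only the root, with its single choice, is left. The induction needs `m` arbitrary.
sum-descendants-level : ∀ n m → sum (List.map (descendants m) (level n)) ≡ ballot (n + m) 1
sum-descendants-level zero    m = ℕ.+-identityʳ _
sum-descendants-level (suc n) m = begin
  sum (List.map (descendants m) (concatMap children (level n)))
    ≡⟨ sum-concatMap (descendants m) children (level n) ⟩
  sum (List.map (sum ∘ List.map (descendants m) ∘ children) (level n))
    ≡⟨ cong sum (List.map-cong (sum-descendants-children m) (level n)) ⟩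
  sum (List.map (descendants (suc m)) (level n))
    ≡⟨ sum-descendants-level n (suc m) ⟩
  ballot (n + suc m) 1
    ≡⟨ cong (λ k → ballot k 1) (ℕ.+-suc n m) ⟩
  ballot (suc n + m) 1 ∎

length-level : ∀ n → length (level n) ≡ catalan n
length-level n = begin
  -- `ballot 0` is constantly 1, so weighting by `descendants 0` counts the nodes.
  length (level n)                        ≡⟨ length≡sum (level n) ⟩
  sum (List.map (descendants 0) (level n)) ≡⟨ sum-descendants-level n 0 ⟩
  ballot (n + 0) 1                        ≡⟨ cong (λ k → ballot k 1) (ℕ.+-identityʳ n) ⟩
  ballot n 1                              ≡⟨ ballot≡catalan n ⟩
  catalan n                               ∎
  where
  length≡sum : ∀ {a} {A : Set a} (xs : List A) → length xs ≡ sum (List.map (λ _ → 1) xs)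
  length≡sum []       = refl
  length≡sum (x ∷ xs) = cong suc (length≡sum xs)

-- Valid codes and fixed points of `θ`

Valid⇒θ-fixed : (c : Code n) → Valid c → θ (val c) ≗ val c
Valid⇒θ-fixed (c ▸ v) (valid , v-ok) = snoc-elim _
  (λ i → begin
    θ (val (c ▸ v)) (inject₁ i)    ≡⟨ θ-val-inject₁ c v i ⟩
    θ (val c) i                    ≡⟨ Valid⇒θ-fixed c valid i ⟩
    val c i                        ≡⟨ val-inject₁ c v i ⟨
    val (c ▸ v) (inject₁ i)        ∎)
  (begin
    θ (val (c ▸ v)) (fromℕ _)      ≡⟨ θ-val-fromℕ c v ⟩
    below (val c) (toℕ v)          ≡⟨ v-ok ⟩
    toℕ v                          ≡⟨ val-fromℕ c v ⟨
    val (c ▸ v) (fromℕ _)          ∎)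

θ-fixed⇒Valid : (c : Code n) → θ (val c) ≗ val c → Valid c
θ-fixed⇒Valid []      _     = tt
θ-fixed⇒Valid (c ▸ v) fixed =
  (θ-fixed⇒Valid c λ i → begin
    θ (val c) i                    ≡⟨ θ-val-inject₁ c v i ⟨
    θ (val (c ▸ v)) (inject₁ i)    ≡⟨ fixed (inject₁ i) ⟩
    val (c ▸ v) (inject₁ i)        ≡⟨ val-inject₁ c v i ⟩
    val c i                        ∎) ,
  (begin
    below (val c) (toℕ v)          ≡⟨ θ-val-fromℕ c v ⟨
    θ (val (c ▸ v)) (fromℕ _)      ≡⟨ fixed (fromℕ _) ⟩
    val (c ▸ v) (fromℕ _)          ≡⟨ val-fromℕ c v ⟩
    toℕ v                          ∎)

-- Transfer to integer vectors

toVec : (Fin n → ℕ) → Vec ℤ n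
toVec f = tabulate (+_ ∘ f)

toVec-injective : {f g : Fin n → ℕ} → toVec f ≡ toVec g → f ≗ g
toVec-injective {f = f} {g} eq i = ℤ.+-injective (begin
  + f i                ≡⟨ Vec.lookup∘tabulate (+_ ∘ f) i ⟨
  lookup (toVec f) i   ≡⟨ cong (λ σ → lookup σ i) eq ⟩
  lookup (toVec g) i   ≡⟨ Vec.lookup∘tabulate (+_ ∘ g) i ⟩
  + g i                ∎)

permutation : Code n → Vec ℤ n
permutation c = toVec (word c)

-- Applying `Θ` to the permutation recovers the code.
permutation-injective : {c d : Code n} → permutation c ≡ permutation d → c ≡ d
permutation-injective {c = c} {d} eq = val-injective c d (toVec-injective (begin
  toVec (val c)      ≡⟨ Θ-tabulate (word c) ⟨
  Θ (permutation c)  ≡⟨ cong Θ eq ⟩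
  Θ (permutation d)  ≡⟨ Θ-tabulate (word d) ⟩
  toVec (val d)      ∎))

Valid⇒S₁ : (c : Code n) → Valid c → S₁ n (permutation c)
Valid⇒S₁ {n} c valid =
  (decode c , Vec.lookup∘tabulate (+_ ∘ word c)) ,
  subst (FP n) (sym (Θ-tabulate (word c)))
    ( (λ i → subst (λ x → (+ 0 ℤ.≤ x) × (x ℤ.< + suc (toℕ i)))
        (sym (Vec.lookup∘tabulate (+_ ∘ val c) i))
        (ℤ.+≤+ z≤n , ℤ.+<+ (s≤s (val≤ c i))))
    , trans (Θ-tabulate (val c)) (Vec.tabulate-cong (cong +_ ∘ Valid⇒θ-fixed c valid)))

-- The code of the given bijection has the same values as `σ`, so `Θ σ` lists its entries and the
-- fixed-point equation for `Θ σ` becomes one for `val c`.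
S₁⇒Valid : ∀ {σ : Vec ℤ n} → S₁ n σ → ∃[ c ] (Valid c × σ ≡ permutation c)
S₁⇒Valid {n} {σ} ((π , σ≡π) , (_ , Θ-fixed)) with decode-surjective π
... | c , decode-c = c , θ-fixed⇒Valid c (toVec-injective fixed) , σ≡
  where
  σ≡ : σ ≡ permutation c
  σ≡ = begin
    σ                      ≡⟨ Vec.tabulate∘lookup σ ⟨
    tabulate (lookup σ)    ≡⟨ Vec.tabulate-cong (λ i →
                                trans (σ≡π i) (cong (+_ ∘ toℕ) (sym (decode-c i)))) ⟩
    permutation c          ∎
  Θσ≡ : Θ σ ≡ toVec (val c)
  Θσ≡ = trans (cong Θ σ≡) (Θ-tabulate (word c))
  fixed : toVec (θ (val c)) ≡ toVec (val c)
  fixed = begin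
    toVec (θ (val c))    ≡⟨ Θ-tabulate (val c) ⟨
    Θ (toVec (val c))    ≡⟨ cong Θ Θσ≡ ⟨
    Θ (Θ σ)              ≡⟨ Θ-fixed ⟩
    Θ σ                  ≡⟨ Θσ≡ ⟩
    toVec (val c)        ∎

corollary5p3 : ∀ (n : ℕ) → HasCardinality (S₁ n) (catalan n)
corollary5p3 n =
  List.map permutation (level n) ,
  Unique.map⁺ permutation-injective (level-unique n) ,
  (λ σ → mk⇔ to from) ,
  trans (List.length-map permutation (level n)) (length-level n)
  where
  to : ∀ {σ : Vec ℤ n} → σ ∈ List.map permutation (level n) → S₁ n σ
  to σ∈ with ∈-map⁻ permutation σ∈
  ... | c , c∈ , refl = Valid⇒S₁ c (∈-level⇒Valid c∈)
  from : ∀ {σ : Vec ℤ n} → S₁ n σ → σ ∈ List.map permutation (level n)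
  from {σ} σ∈S₁ with S₁⇒Valid {n} {σ} σ∈S₁
  ... | c , valid , refl = ∈-map⁺ permutation (Valid⇒∈-level c valid)
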